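{- Let $\ell\ge 3$ and $n\ge \ell+3$, and consider the instance of $M3 \mid prpt \mid C_{\max}$ with $p_i=\frac{1}{\ell-1}$ for $i=1,\dots,\ell$, $q_{\ell+1}=1$, and $q_i=\frac{1}{n-\ell-2}$ for $i=\ell+2,\dots,n$. For this instance the schedule $\pi$ described in the context has makespan $C^{\pi}_{\max}=4+\frac{1}{\ell-1}$, while an optimal schedule has makespan $C^*_{\max}=3+\frac{1}{\ell-1}+\frac{1}{n-\ell-2}$. Consequently the approximation ratio $4/3$ of the algorithm that outputs $\pi$ is asymptotically tight (the ratio $C^{\pi}_{\max}/C^*_{\max}$ tends to $4/3$ as $\ell\to\infty$ and $n-\ell\to\infty$).
   Context: Problem $M3 \mid prpt \mid C_{\max}$. There are three machines $M_1,M_2,M_3$ and a set $\mathcal{J}=\mathcal{F}\cup\mathcal{O}$ of $n$ jobs, with flow-shop jobs $\mathcal{F}=\{J_1,\dots,J_\ell\}$ and open-shop jobs $\mathcal{O}=\{J_{\ell+1},\dots,J_n\}$. Each $J_i\in\mathcal{F}$ must be processed non-preemptively on $M_1$, then $M_2$, then $M_3$, with processing time $p_i>0$ on each machine. Each $J_i\in\mathcal{O}$ must be processed non-preemptively on each of the three machines, in any machine order, with processing time $q_i>0$ on each machine. At every time a job is processed by at most one machine and a machine processes at most one job. A feasible schedule starts at time $0$ and its makespan is the maximum completion time of a job; the minimum makespan is denoted $C^*_{\max}$. Jobs are indexed so that $p_1\ge\dots\ge p_\ell$ and $q_{\ell+1}\ge\dots\ge q_n$. The schedule $\pi$ (output by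 the algorithm when $p_1<q_{\ell+1}$ and there are at least two open-shop jobs). The order of jobs on $M_1$ is $\langle J_{\ell+3},\dots,J_n,\mathcal{F},J_{\ell+1},J_{\ell+2}\rangle$; on $M_2$ it is $\langle J_{\ell+2},J_{\ell+3},\dots,J_n,\mathcal{F},J_{\ell+1}\rangle$; on $M_3$ it is $\langle J_{\ell+1},J_{\ell+2},J_{\ell+3},\dots,J_n,\mathcal{F}\rangle$; in each case the jobs of $\mathcal{F}$ are in the longest-processing-time-first order. The job $J_{\ell+3}$ starts at time $0$ on $M_1$, at time $q_{\ell+1}$ on $M_2$ and at time $2q_{\ell+1}$ on $M_3$. $J_{\ell+2}$ starts at time $0$ on $M_2$ and at time $q_{\ell+1}$ on $M_3$, and $J_{\ell+1}$ starts at time $0$ on $M_3$. All remaining operations start as early as these orders and the feasibility constraints permit.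
   Formalization: Schedules have rational start times, so "optimal" and "as early as permitted" compare only with feasible schedules whose operations start at rational times, not arbitrary real times. -}

module Defs where

open import Data.Fin.Base as Fin using (Fin; toℕ; inject≤)
open import Data.Fin.Patterns using (0F; 1F; 2F)
open import Data.Integer.Base as ℤ using (+_)
import Data.Integer.Properties as ℤ
open import Data.List.Base using (List; _++_; map; take; drop; allFin)
import Data.List.Extrema
open import Data.List.Membership.Propositional.Properties
  using (∈-map⁺; ∈-++⁺ʳ; ∈-allFin)
open import Data.List.Relation.Unary.All as All using ()
open import Data.List.Relation.Unary.AllPairs using (AllPairs)
open import Data.Nat.Base as ℕ using (ℕ; suc)
import Data.Nat.Properties as ℕ
open import Data.Product.Base using (_×_)
open import Data.Rational.Base
open import Data.Rational.Properties
import Data.Rational.Unnormalised.Base as ℚᵘ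
import Data.Rational.Unnormalised.Properties as ℚᵘ
open import Relation.Binary.Bundles using (DecTotalOrder)
open import Relation.Binary.PropositionalEquality using (_≡_; subst)

module Extrema = Data.List.Extrema (DecTotalOrder.totalOrder ≤-decTotalOrder)

data Machine : Set where
  M₁ M₂ M₃ : Machine

-- `flowJob i` is J_{i+1} and `openJob i` is J_{ℓ+1+i}, where ℓ is the number
-- of flow-shop jobs: indices are 0-based here and 1-based in the mathematics.
data Job (ℓ k : ℕ) : Set where
  flowJob : Fin ℓ → Job ℓ k
  openJob : Fin k → Job ℓ k

-- An instance of M3 | prpt | C_max with ℓ flow-shop and k = n - ℓ open-shop
-- jobs.
record Instance : Set where
  field
    ℓ k      : ℕ
    p        : Fin ℓ → ℚ
    q        : Fin k → ℚ
    p-pos    : ∀ i → 0ℚ < p i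
    q-pos    : ∀ i → 0ℚ < q i
    p-sorted : ∀ {i j} → i Fin.≤ j → p j ≤ p i
    q-sorted : ∀ {i j} → i Fin.≤ j → q j ≤ q i

  time : Job ℓ k → ℚ
  time (flowJob i) = p i
  time (openJob i) = q i

  flowJobs openJobs allJobs : List (Job ℓ k)
  flowJobs = map flowJob (allFin ℓ)
  openJobs = map openJob (allFin k)
  allJobs  = flowJobs ++ openJobs

-- A feasible schedule.  Processing is non-preemptive, so a schedule is given by
-- the start time of each operation.
record Schedule (I : Instance) : Set where
  open Instance I

  field
    start : Machine → Job ℓ k → ℚ

  finish : Machine → Job ℓ k → ℚ
  finish m j = start m j + time j

  Processing : Machine → Job ℓ k → ℚ → Set
  Processing m j t = start m j ≤ t × t < finish m j

  field
    start≥0     : ∀ m j → 0ℚ ≤ start m j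
    one-machine : ∀ {m m′} j t → Processing m j t → Processing m′ j t → m ≡ m′
    one-job     : ∀ m {j j′} t → Processing m j t → Processing m j′ t → j ≡ j′
    flow-M₁-M₂  : ∀ i → finish M₁ (flowJob i) ≤ start M₂ (flowJob i)
    flow-M₂-M₃  : ∀ i → finish M₂ (flowJob i) ≤ start M₃ (flowJob i)

  completion : Job ℓ k → ℚ
  completion j = finish M₁ j ⊔ finish M₂ j ⊔ finish M₃ j

  -- The default 0ℚ matters only when there are no jobs, since completion times
  -- are positive.
  makespan : ℚ
  makespan = Extrema.max 0ℚ (map completion allJobs)

open Schedule using (start; finish; makespan)

IsOptimal : ∀ {I} → Schedule I → Set
IsOptimal {I} σ = (τ : Schedule I) → makespan σ ≤ makespan τ

-- The schedule π, for an instance with at least three open-shop jobs (so that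
-- J_{ℓ+3} exists).
module _ (I : Instance) (3≤k : 3 ℕ.≤ Instance.k I) where
  open Instance I

  J[ℓ+1] J[ℓ+2] J[ℓ+3] : Job ℓ k
  J[ℓ+1] = openJob (inject≤ 0F 3≤k)
  J[ℓ+2] = openJob (inject≤ 1F 3≤k)
  J[ℓ+3] = openJob (inject≤ 2F 3≤k)

  q[ℓ+1] : ℚ
  q[ℓ+1] = time J[ℓ+1]

  -- The flow-shop jobs are indexed by non-increasing processing time, so
  -- `flowJobs` is already in longest-processing-time-first order.
  order : Machine → List (Job ℓ k)
  order M₁ = drop 2 openJobs ++ flowJobs ++ take 2 openJobs
  order M₂ = drop 1 openJobs ++ flowJobs ++ take 1 openJobs
  order M₃ = openJobs ++ flowJobs

  record Respects-π (σ : Schedule I) : Set where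
    field
      ordered   : ∀ m → AllPairs (λ j j′ → finish σ m j ≤ start σ m j′) (order m)
      ℓ+3-on-M₁ : start σ M₁ J[ℓ+3] ≡ 0ℚ
      ℓ+3-on-M₂ : start σ M₂ J[ℓ+3] ≡ q[ℓ+1]
      ℓ+3-on-M₃ : start σ M₃ J[ℓ+3] ≡ q[ℓ+1] + q[ℓ+1]
      ℓ+2-on-M₂ : start σ M₂ J[ℓ+2] ≡ 0ℚ
      ℓ+2-on-M₃ : start σ M₃ J[ℓ+2] ≡ q[ℓ+1]
      ℓ+1-on-M₃ : start σ M₃ J[ℓ+1] ≡ 0ℚ

  -- "As early as the orders and the feasibility constraints permit": no
  -- operation starts earlier in any feasible schedule with the same orders and
  -- prescribed start times.  This determines all start times uniquely.
  record Is-π (σ : Schedule I) : Set where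
    field
      p₁<q[ℓ+1] : ∀ i → toℕ i ≡ 0 → p i < q[ℓ+1]
      respects  : Respects-π σ
      earliest  : ∀ τ → Respects-π τ → ∀ m j → start σ m j ≤ start τ m j

0<1/d : ∀ d .{{_ : ℕ.NonZero d}} → 0ℚ < + 1 / d
0<1/d d = positive⁻¹ (+ 1 / d) {{normalize-pos 1 d}}

1/d≤1 : ∀ d .{{_ : ℕ.NonZero d}} → + 1 / d ≤ 1ℚ
1/d≤1 (suc d) = toℚᵘ-cancel-≤
  (ℚᵘ.≤-respˡ-≃ (ℚᵘ.≃-sym (toℚᵘ-fromℚᵘ (ℚᵘ.mkℚᵘ (+ 1) d)))
    (ℚᵘ.*≤* (ℤ.+≤+ (ℕ.s≤s ℕ.z≤n))))

module TightInstance (ℓ n : ℕ) (3≤ℓ : 3 ℕ.≤ ℓ) (ℓ+3≤n : ℓ ℕ.+ 3 ℕ.≤ n) where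

  3≤n∸ℓ : 3 ℕ.≤ n ℕ.∸ ℓ
  3≤n∸ℓ = ℕ.m+n≤o⇒m≤o∸n 3 (subst (ℕ._≤ n) (ℕ.+-comm ℓ 3) ℓ+3≤n)

  instance
    ℓ∸1-nonZero : ℕ.NonZero (ℓ ℕ.∸ 1)
    ℓ∸1-nonZero = ℕ.>-nonZero (ℕ.≤-trans (ℕ.s≤s ℕ.z≤n) (ℕ.∸-monoˡ-≤ 1 3≤ℓ))

    n∸ℓ∸2-nonZero : ℕ.NonZero (n ℕ.∸ ℓ ℕ.∸ 2)
    n∸ℓ∸2-nonZero = ℕ.>-nonZero (ℕ.∸-monoˡ-≤ 2 3≤n∸ℓ)

  1/[ℓ-1] 1/[n-ℓ-2] : ℚ
  1/[ℓ-1]   = + 1 / (ℓ ℕ.∸ 1)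
  1/[n-ℓ-2] = + 1 / (n ℕ.∸ ℓ ℕ.∸ 2)

  openTime : ∀ {k} → Fin k → ℚ
  openTime Fin.zero    = 1ℚ
  openTime (Fin.suc _) = 1/[n-ℓ-2]

  openTime-pos : ∀ {k} (i : Fin k) → 0ℚ < openTime i
  openTime-pos Fin.zero    = positive⁻¹ 1ℚ
  openTime-pos (Fin.suc _) = 0<1/d (n ℕ.∸ ℓ ℕ.∸ 2)

  openTime-sorted : ∀ {k} {i j : Fin k} → i Fin.≤ j → openTime j ≤ openTime i
  openTime-sorted {i = Fin.zero}  {Fin.zero}  _ = ≤-refl
  openTime-sorted {i = Fin.zero}  {Fin.suc _} _ = 1/d≤1 (n ℕ.∸ ℓ ℕ.∸ 2)
  openTime-sorted {i = Fin.suc _} {Fin.suc _} _ = ≤-refl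

  tight : Instance
  tight = record
    { ℓ        = ℓ
    ; k        = n ℕ.∸ ℓ
    ; p        = λ _ → 1/[ℓ-1]
    ; q        = openTime
    ; p-pos    = λ _ → 0<1/d (ℓ ℕ.∸ 1)
    ; q-pos    = openTime-pos
    ; p-sorted = λ _ → ≤-refl
    ; q-sorted = openTime-sorted
    }

  IsPi : Schedule tight → Set
  IsPi = Is-π tight 3≤n∸ℓ

  makespan-pos : (σ : Schedule tight) → 0ℚ < makespan σ
  makespan-pos σ = <-≤-trans 0<finish (≤-trans finish≤completion completion≤makespan)
    where
    open Instance tight using (flowJobs; time)
    open Schedule σ using (start≥0; completion)

    j : Job ℓ (n ℕ.∸ ℓ)
    j = openJob (inject≤ 0F 3≤n∸ℓ)

    0<finish : 0ℚ < finish σ M₃ j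
    0<finish = subst (_< finish σ M₃ j) (+-identityʳ 0ℚ)
      (+-mono-≤-< (start≥0 M₃ j) (openTime-pos (inject≤ 0F 3≤n∸ℓ)))

    finish≤completion : finish σ M₃ j ≤ completion j
    finish≤completion = p≤q⊔p (finish σ M₁ j ⊔ finish σ M₂ j) (finish σ M₃ j)

    completion≤makespan : completion j ≤ makespan σ
    completion≤makespan = All.lookup (Extrema.xs≤max 0ℚ _)
      (∈-map⁺ completion (∈-++⁺ʳ flowJobs (∈-map⁺ openJob (∈-allFin _))))

  ratio : (π σ : Schedule tight) → ℚ
  ratio π σ = (makespan π ÷ makespan σ) {{>-nonZero (makespan-pos σ)}}

{-# OPTIONS --safe #-}

-- Write a = 1/(ℓ-1) and b = 1/(n-ℓ-2).  The flow-shop jobs need 1 + a on each machine,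
-- the long open-shop job 1, and the short ones 1 + b, so every machine carries a load of
-- 3 + a + b, which bounds all makespans from below.  The bound is attained without idle
-- time by rotating the flow-shop block F, the long job O and the block B of short jobs:
-- F, O, B on M₁, then B, F, O on M₂, then O, B, F on M₃.
--
-- In π the prescribed starts leave at most one idle interval on M₂ and on M₃, and after it
-- all operations run back to back.  Hence π starts every operation as early as its order alone
-- allows, and M₂ ends with the long job at (3 + a) + 1.

module Submission where

open import Defs
open import Data.Integer.Base using (+_)
open import Data.Nat.Base as ℕ using (ℕ)
open import Data.Product.Base using (_×_; ∃-syntax)
open import Data.Rational.Base using (ℚ; 0ℚ; _<_; _+_; _-_; _/_; ∣_∣)
open import Relation.Binary.PropositionalEquality using (_≡_)

import Algebra.Definitions.RawMonoid
open import Data.Empty using (⊥)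
open import Data.Fin.Base as Fin using (Fin; toℕ; zero; suc)
import Data.Integer.Base as ℤ
import Data.Integer.Properties as ℤ
open import Data.Integer.Tactic.RingSolver using (solve-∀)
open import Data.List.Base
  using (List; []; _∷_; _++_; map; take; drop; allFin; tabulate; foldr)
open import Data.List.Membership.Propositional using (_∈_)
open import Data.List.Membership.Propositional.Properties
  using (∈-map⁺; ∈-map⁻; ∈-++⁺ˡ; ∈-++⁺ʳ; ∈-++⁻; ∈-allFin)
open import Data.List.Properties using (take++drop≡id)
open import Data.List.Relation.Binary.Permutation.Propositional as ↭
  using (_↭_; ↭-refl; ↭-trans; ↭-sym; prep; swap)
open import Data.List.Relation.Binary.Permutation.Propositional.Properties using (All-resp-↭)
open import Data.List.Relation.Unary.All as All using (All; []; _∷_)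
import Data.List.Relation.Unary.All.Properties as All
open import Data.List.Relation.Unary.AllPairs as AllPairs using (AllPairs; []; _∷_)
open import Data.List.Relation.Unary.Any using (here; there)
open import Data.List.Relation.Unary.Linked using (Linked; [-]; _∷_)
open import Data.List.Relation.Unary.Linked.Properties using (Linked⇒AllPairs)
open import Data.List.Relation.Unary.Unique.Propositional using (Unique)
import Data.List.Relation.Unary.Unique.Propositional.Properties as Unique
import Data.Nat.Properties as ℕ
open import Data.Product.Base using (_,_)
open import Data.Rational.Base
  using ( 1ℚ; _≤_; _⊔_; _*_; _÷_; -_; 1/_; mkℚ; ↧ₙ_; toℚᵘ; fromℚᵘ; *<*; +-0-rawMonoid
        ; NonZero; Positive; NonNegative; positive; nonNegative; >-nonZero)
open import Data.Rational.Properties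
open import Data.Rational.Solver using (module +-*-Solver)
open import Data.Rational.Unnormalised.Base as ℚᵘ using (mkℚᵘ; *≡*)
import Data.Rational.Unnormalised.Properties as ℚᵘ
open import Data.Sum.Base using (_⊎_; inj₁; inj₂; [_,_]′)
open import Function.Base using (case_of_; id)
open import Relation.Binary.PropositionalEquality
  using (_≢_; refl; sym; trans; cong; cong₂; subst)
open import Relation.Nullary using (yes; no; contradiction)

open Algebra.Definitions.RawMonoid +-0-rawMonoid using () renaming (_×_ to _·_)
open +-*-Solver using (solve; _:=_; _:+_; _:-_; _:*_; :-_; con)

-- Inequalities between rationals

+-nonNeg : ∀ {x y} → 0ℚ ≤ x → 0ℚ ≤ y → 0ℚ ≤ x + y
+-nonNeg = +-mono-≤

·-nonNeg : ∀ {x} n → 0ℚ ≤ x → 0ℚ ≤ n · x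
·-nonNeg ℕ.zero    0≤x = ≤-refl
·-nonNeg (ℕ.suc n) 0≤x = +-nonNeg 0≤x (·-nonNeg n 0≤x)

x≤x+y : ∀ {x y} → 0ℚ ≤ y → x ≤ x + y
x≤x+y {x} {y} 0≤y = subst (_≤ x + y) (+-identityʳ x) (+-monoʳ-≤ x 0≤y)

≤-by : ∀ {x y} r → 0ℚ ≤ r → y ≡ x + r → x ≤ y
≤-by r 0≤r refl = x≤x+y 0≤r

x≤y⇒0≤y-x : ∀ {x y} → x ≤ y → 0ℚ ≤ y - x
x≤y⇒0≤y-x {x} {y} x≤y = subst (_≤ y - x) (+-inverseʳ x) (+-monoˡ-≤ (- x) x≤y)

-- Intervals on one resource: gapless runs, ordered chains and packing

module _ {A : Set} (start time : A → ℚ) where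

  Before : A → A → Set
  Before x y = start x + time x ≤ start y

  -- Gapless processing from the first time to the second. Starts and the end enter through
  -- equations, so each can be given in simplified form instead of as a literal sum.
  data Run : ℚ → List A → ℚ → Set where
    stop : ∀ {s t} → s ≡ t → Run s [] t
    _∷_  : ∀ {s t x xs} → start x ≡ s → Run (s + time x) xs t → Run s (x ∷ xs) t

module _ {A : Set} {start time : A → ℚ} where

  infixr 5 _++ʳ_
  _++ʳ_ : ∀ {s t u xs ys} → Run start time s xs t → Run start time t ys u →
          Run start time s (xs ++ ys) u
  stop refl ++ʳ rs = rs
  (eq ∷ r)  ++ʳ rs = eq ∷ (r ++ʳ rs)

  -- A block of equal jobs. Keeping `g` apart from `f` lets the induction shift `g` alone, and
  -- `map f (tabulate g)` is the shape to which `flowJobs` and the tails of `openJobs` reduce.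
  run-tabulate : ∀ {B : Set} {n} (f : B → A) (g : Fin n → B) {s t c} →
                 (∀ i → start (f (g i)) ≡ s + toℕ i · c) → (∀ i → time (f (g i)) ≡ c) →
                 s + n · c ≡ t → Run start time s (map f (tabulate g)) t
  run-tabulate {n = ℕ.zero}  f g {s} starts times end = stop (trans (sym (+-identityʳ s)) end)
  run-tabulate {n = ℕ.suc n} f g {s} {t} {c} starts times end =
    trans (starts zero) (+-identityʳ s) ∷
    run-tabulate f (λ i → g (suc i))
      (λ i → trans (starts (suc i)) (shift (toℕ i)))
      (λ i → times (suc i))
      (trans (sym (shift n)) end)
    where
    shift : ∀ k → s + (c + k · c) ≡ s + time (f (g zero)) + k · c
    shift k rewrite times zero = sym (+-assoc s c (k · c))

  run-total : ∀ {s xs t} → Run start time s xs t → s + foldr _+_ 0ℚ (map time xs) ≡ t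
  run-total {s} (stop refl) = +-identityʳ s
  run-total {s} (_ ∷ r)     = trans (sym (+-assoc s _ _)) (run-total r)

  -- Of two different entries, the earlier one finishes before the later one starts, so no `t` lies
  -- in both intervals. It serves for the jobs on a machine and for the machines on the route of a
  -- job.
  exclusive : ∀ {xs x y} → AllPairs (Before start time) xs → x ∈ xs → y ∈ xs → ∀ t →
              start x ≤ t × t < start x + time x → start y ≤ t × t < start y + time y → x ≡ y
  exclusive (_ ∷ _)  (here refl) (here refl) _ _ _ = refl
  exclusive (b ∷ _)  (here refl) (there y∈)  t (_ , t<x) (y≤t , _) =
    contradiction (<-≤-trans t<x (≤-trans (All.lookup b y∈) y≤t)) (<-irrefl refl)
  exclusive (b ∷ _)  (there x∈)  (here refl) t (x≤t , _) (_ , t<y) =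
    contradiction (<-≤-trans t<y (≤-trans (All.lookup b x∈) x≤t)) (<-irrefl refl)
  exclusive (_ ∷ bs) (there x∈)  (there y∈)  = exclusive bs x∈ y∈

  module _ (time≥0 : ∀ x → 0ℚ ≤ time x) where

    Before-trans : ∀ {x y z} → Before start time x y → Before start time y z → Before start time x z
    Before-trans {y = y} x<y y<z = ≤-trans x<y (≤-trans (x≤x+y (time≥0 y)) y<z)

    -- Spreads a prescribed start of the head to everything ordered after it.
    starts-after : ∀ {s x xs} → s ≤ start x → AllPairs (Before start time) (x ∷ xs) →
                   All (λ y → s ≤ start y) (x ∷ xs)
    starts-after {x = x} s≤x (b ∷ _) =
      s≤x ∷ All.map (≤-trans (≤-trans s≤x (x≤x+y (time≥0 x)))) b

    run-starts : ∀ {s xs t} → Run start time s xs t → All (λ x → s ≤ start x) xs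
    run-starts (stop _) = []
    run-starts (_∷_ {x = x} eq r) =
      ≤-reflexive (sym eq) ∷ All.map (≤-trans (x≤x+y (time≥0 x))) (run-starts r)

    run-length : ∀ {s xs t} → Run start time s xs t → s ≤ t
    run-length (stop eq)         = ≤-reflexive eq
    run-length (_∷_ {x = x} _ r) = ≤-trans (x≤x+y (time≥0 x)) (run-length r)

    run-finishes : ∀ {s xs t} → Run start time s xs t → All (λ x → start x + time x ≤ t) xs
    run-finishes (stop _)             = []
    run-finishes (_∷_ {x = x} refl r) = run-length r ∷ run-finishes r

    run-ordered : ∀ {s xs t} → Run start time s xs t → AllPairs (Before start time) xs
    run-ordered (stop _)   = []
    run-ordered (refl ∷ r) = run-starts r ∷ run-ordered r

    -- The walk stops at the first entry that `x` precedes; by transitivity `x` precedes all later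
    -- entries too.
    insert : ∀ x {ys} → All (λ y → Before start time x y ⊎ Before start time y x) ys →
             AllPairs (Before start time) ys →
             ∃[ zs ] (zs ↭ x ∷ ys × AllPairs (Before start time) zs)
    insert x [] [] = x ∷ [] , ↭-refl , [] ∷ []
    insert x {y ∷ ys} (inj₁ x<y ∷ ds) (b ∷ bs) =
      x ∷ y ∷ ys , ↭-refl , (x<y ∷ All.map (Before-trans x<y) b) ∷ b ∷ bs
    insert x {y ∷ ys} (inj₂ y<x ∷ ds) (b ∷ bs) with insert x ds bs
    ... | zs , zs↭ , bs′ =
      y ∷ zs , ↭-trans (prep y zs↭) (swap y x ↭-refl) , All-resp-↭ (↭-sym zs↭) (y<x ∷ b) ∷ bs′

    -- Insertion sort: disjoint intervals are comparable by `Before`, which is transitive because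
    -- times are nonnegative.
    serialise : ∀ {xs} → AllPairs (λ x y → Before start time x y ⊎ Before start time y x) xs →
                ∃[ zs ] (zs ↭ xs × AllPairs (Before start time) zs)
    serialise [] = [] , ↭-refl , []
    serialise (_∷_ {x} d ds) with serialise ds
    ... | zs , zs↭ , bs with insert x (All-resp-↭ (↭-sym zs↭) d) bs
    ... | ys , ys↭ , bs′ = ys , ↭-trans ys↭ (prep x zs↭) , bs′

  total-↭ : ∀ {xs ys} → xs ↭ ys → foldr _+_ 0ℚ (map time xs) ≡ foldr _+_ 0ℚ (map time ys)
  total-↭ ↭.refl        = refl
  total-↭ (prep x p)    = cong (_+_ (time x)) (total-↭ p)
  total-↭ (swap x y p)  = trans (cong (λ z → time x + (time y + z)) (total-↭ p))
    (solve 3 (λ u v w → u :+ (v :+ w) := v :+ (u :+ w)) refl (time x) (time y) _)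
  total-↭ (↭.trans p q) = trans (total-↭ p) (total-↭ q)

  -- The induction moves `s` past the head; the invariant `s ≤ t` settles the empty list.
  chain-total : ∀ {xs s t} → s ≤ t → AllPairs (Before start time) xs →
                All (λ x → s ≤ start x) xs → All (λ x → start x + time x ≤ t) xs →
                s + foldr _+_ 0ℚ (map time xs) ≤ t
  chain-total {s = s} s≤t [] [] [] = ≤-trans (≤-reflexive (+-identityʳ s)) s≤t
  chain-total {x ∷ _} {s} s≤t (b ∷ bs) (s≤x ∷ _) (x≤t ∷ fs) =
    ≤-trans (≤-reflexive (sym (+-assoc s _ _)))
      (chain-total (≤-trans s+≤ x≤t) bs (All.map (≤-trans s+≤) b) fs)
    where
    s+≤ : s + time x ≤ start x + time x
    s+≤ = +-monoˡ-≤ (time x) s≤x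

  -- Disjoint intervals inside a window have total length at most that of the window: sort them,
  -- then add up along the chain.
  packing : (∀ x → 0ℚ ≤ time x) → ∀ {xs s t} → s ≤ t →
            AllPairs (λ x y → Before start time x y ⊎ Before start time y x) xs →
            All (λ x → s ≤ start x) xs → All (λ x → start x + time x ≤ t) xs →
            s + foldr _+_ 0ℚ (map time xs) ≤ t
  packing time≥0 {s = s} s≤t ds ss fs with serialise time≥0 ds
  ... | zs , zs↭ , bs = subst (λ z → s + z ≤ _) (total-↭ zs↭)
    (chain-total s≤t bs (All-resp-↭ (↭-sym zs↭) ss) (All-resp-↭ (↭-sym zs↭) fs))

  -- By induction along the list: a run has no gap, so each entry starts exactly at the lower bound
  -- that the order and the time `s` force on any `start′`.
  run-earliest : ∀ {start′ s xs t} → Run start time s xs t → AllPairs (Before start′ time) xs →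
                 All (λ x → s ≤ start′ x) xs → All (λ x → start x ≤ start′ x) xs
  run-earliest (stop _) [] [] = []
  run-earliest (_∷_ {x = x} refl r) (b ∷ bs) (s≤x ∷ _) =
    s≤x ∷ run-earliest r bs (All.map (≤-trans (+-monoˡ-≤ (time x) s≤x)) b)

-- Schedules of an arbitrary instance: load bound and a criterion for feasibility

module _ {I : Instance} where
  open Instance I
  open Schedule

  time>0 : ∀ j → 0ℚ < time j
  time>0 (flowJob i) = p-pos i
  time>0 (openJob i) = q-pos i

  time≥0 : ∀ j → 0ℚ ≤ time j
  time≥0 j = <⇒≤ (time>0 j)

  ∈-flowJobs : ∀ i → flowJob i ∈ flowJobs
  ∈-flowJobs i = ∈-map⁺ flowJob (∈-allFin i)

  ∈-openJobs : ∀ i → openJob i ∈ openJobs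
  ∈-openJobs i = ∈-map⁺ openJob (∈-allFin i)

  ∈-allJobs : ∀ j → j ∈ allJobs
  ∈-allJobs (flowJob i) = ∈-++⁺ˡ (∈-flowJobs i)
  ∈-allJobs (openJob i) = ∈-++⁺ʳ flowJobs (∈-openJobs i)

  ∈-rotation : ∀ c j → j ∈ drop c openJobs ++ flowJobs ++ take c openJobs
  ∈-rotation c (flowJob i) = ∈-++⁺ʳ (drop c openJobs) (∈-++⁺ˡ (∈-flowJobs i))
  ∈-rotation c (openJob i)
    with ∈-++⁻ (take c openJobs) (subst (openJob i ∈_) (sym (take++drop≡id c openJobs)) (∈-openJobs i))
  ... | inj₁ i∈take = ∈-++⁺ʳ (drop c openJobs) (∈-++⁺ʳ flowJobs i∈take)
  ... | inj₂ i∈drop = ∈-++⁺ˡ i∈drop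

  ∈-order : ∀ 3≤k m j → j ∈ order I 3≤k m
  ∈-order _ M₁ j = ∈-rotation 2 j
  ∈-order _ M₂ j = ∈-rotation 1 j
  ∈-order _ M₃ (flowJob i) = ∈-++⁺ʳ openJobs (∈-flowJobs i)
  ∈-order _ M₃ (openJob i) = ∈-++⁺ˡ (∈-openJobs i)

  finish≤makespan : ∀ (σ : Schedule I) m j → finish σ m j ≤ makespan σ
  finish≤makespan σ m j = ≤-trans (≤completion m)
    (All.lookup (Extrema.xs≤max 0ℚ _) (∈-map⁺ (completion σ) (∈-allJobs j)))
    where
    ≤completion : ∀ m → finish σ m j ≤ completion σ j
    ≤completion M₁ = ≤-trans (p≤p⊔q (finish σ M₁ j) (finish σ M₂ j)) (p≤p⊔q _ (finish σ M₃ j))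
    ≤completion M₂ = ≤-trans (p≤q⊔p (finish σ M₁ j) _) (p≤p⊔q _ (finish σ M₃ j))
    ≤completion M₃ = p≤q⊔p (finish σ M₁ j ⊔ finish σ M₂ j) _

  -- The bound `0ℚ ≤ t` accounts for the default value of the maximum in `makespan`.
  makespan≤ : ∀ (σ : Schedule I) {t} → 0ℚ ≤ t → (∀ m j → finish σ m j ≤ t) → makespan σ ≤ t
  makespan≤ σ 0≤t finish≤t = Extrema.max≤v⁺ {xs = map (completion σ) allJobs} 0≤t
    (All.map⁺ (All.tabulate (λ {j} _ → ⊔-lub (⊔-lub (finish≤t M₁ j) (finish≤t M₂ j)) (finish≤t M₃ j))))

  0≤makespan : ∀ (σ : Schedule I) → 0ℚ ≤ makespan σ
  0≤makespan σ = Extrema.⊥≤max 0ℚ (map (completion σ) allJobs)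

  makespan-mono : ∀ (σ τ : Schedule I) → (∀ m j → start σ m j ≤ start τ m j) →
                  makespan σ ≤ makespan τ
  makespan-mono σ τ σ≤τ = makespan≤ σ (0≤makespan τ) (λ m j →
    ≤-trans (+-monoˡ-≤ (time j) (σ≤τ m j)) (finish≤makespan τ m j))

  start<finish : ∀ (σ : Schedule I) m j → start σ m j < finish σ m j
  start<finish σ m j = subst (_< finish σ m j) (+-identityʳ _) (+-monoʳ-< (start σ m j) (time>0 j))

  -- If neither job preceded the other, both would be in process at the later of their two starts,
  -- against `one-job`.
  disjoint : ∀ (σ : Schedule I) m {j j′} → j ≢ j′ →
             finish σ m j ≤ start σ m j′ ⊎ finish σ m j′ ≤ start σ m j
  disjoint σ m {j} {j′} j≢j′ with finish σ m j ≤? start σ m j′ | finish σ m j′ ≤? start σ m j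
  ... | yes j≤j′ | _        = inj₁ j≤j′
  ... | no  _    | yes j′≤j = inj₂ j′≤j
  ... | no  j≰j′ | no  j′≰j with ≤-total (start σ m j) (start σ m j′)
  ...   | inj₁ s≤s′ = contradiction (one-job σ m _ (s≤s′ , ≰⇒> j≰j′) (≤-refl , start<finish σ m j′)) j≢j′
  ...   | inj₂ s′≤s = contradiction (one-job σ m _ (≤-refl , start<finish σ m j) (s′≤s , ≰⇒> j′≰j)) j≢j′

  distinct-allJobs : Unique allJobs
  distinct-allJobs = Unique.++⁺
    (Unique.map⁺ (λ { refl → refl }) (Unique.allFin⁺ ℓ))
    (Unique.map⁺ (λ { refl → refl }) (Unique.allFin⁺ k))
    λ (j∈F , j∈O) → flow≢open (∈-map⁻ flowJob j∈F) (∈-map⁻ openJob j∈O)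
    where
    flow≢open : ∀ {j : Job ℓ k} → ∃[ i ] (i ∈ allFin ℓ × j ≡ flowJob i) →
                ∃[ i ] (i ∈ allFin k × j ≡ openJob i) → ⊥
    flow≢open (_ , _ , refl) (_ , _ , ())

  -- A job takes the same time on each machine, so all three loads agree and packing `M₁` gives the
  -- bound.
  load≤makespan : ∀ (σ : Schedule I) → foldr _+_ 0ℚ (map time allJobs) ≤ makespan σ
  load≤makespan σ = ≤-trans (≤-reflexive (sym (+-identityˡ _)))
    (packing time≥0 (0≤makespan σ) (AllPairs.map (disjoint σ M₁) distinct-allJobs)
      (All.tabulate (λ {j} _ → start≥0 σ M₁ j)) (All.tabulate (λ {j} _ → finish≤makespan σ M₁ j)))

  -- In both schedules built below every job visits the machines in a cyclic shift of `M₁`, `M₂`,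
  -- `M₃`, so its first machine determines its route.
  cycleFrom : Machine → List Machine
  cycleFrom M₁ = M₁ ∷ M₂ ∷ M₃ ∷ []
  cycleFrom M₂ = M₂ ∷ M₃ ∷ M₁ ∷ []
  cycleFrom M₃ = M₃ ∷ M₁ ∷ M₂ ∷ []

  ∈-cycleFrom : ∀ m m′ → m′ ∈ cycleFrom m
  ∈-cycleFrom M₁ M₁ = here refl
  ∈-cycleFrom M₁ M₂ = there (here refl)
  ∈-cycleFrom M₁ M₃ = there (there (here refl))
  ∈-cycleFrom M₂ M₁ = there (there (here refl))
  ∈-cycleFrom M₂ M₂ = here refl
  ∈-cycleFrom M₂ M₃ = there (here refl)
  ∈-cycleFrom M₃ M₁ = there (here refl)
  ∈-cycleFrom M₃ M₂ = there (there (here refl))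
  ∈-cycleFrom M₃ M₃ = here refl

  -- Feasibility reduces to two families of chains: the jobs along each machine and the machines
  -- along each route. Flow-shop routes begin at `M₁`, which yields the flow constraints.
  schedule : (s : Machine → Job ℓ k → ℚ) → (∀ m j → 0ℚ ≤ s m j) →
             (order : Machine → List (Job ℓ k)) → (∀ m j → j ∈ order m) →
             (∀ m → AllPairs (Before (s m) time) (order m)) →
             (first : Job ℓ k → Machine) → (∀ i → first (flowJob i) ≡ M₁) →
             (∀ j → Linked (Before (λ m → s m j) (λ _ → time j)) (cycleFrom (first j))) →
             Schedule I
  schedule s s≥0 order ∈order ordered first first-flow routed = record
    { start       = s
    ; start≥0     = s≥0
    ; one-machine = λ j → exclusive
        (Linked⇒AllPairs (λ {m} {m′} {m″} → Before-trans (λ _ → time≥0 j) {m} {m′} {m″}) (routed j))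
        (∈-cycleFrom (first j) _) (∈-cycleFrom (first j) _)
    ; one-job     = λ m → exclusive (ordered m) (∈order m _) (∈order m _)
    ; flow-M₁-M₂  = λ i → case flow-routed i of λ { (M₁≤M₂ ∷ _) → M₁≤M₂ }
    ; flow-M₂-M₃  = λ i → case flow-routed i of λ { (_ ∷ M₂≤M₃ ∷ _) → M₂≤M₃ }
    }
    where
    -- Replacing `first (flowJob i)` by `M₁` makes the cycle compute, so that the two links can be
    -- matched.
    flow-routed : ∀ i → Linked (Before (λ m → s m (flowJob i)) (λ _ → p i)) (cycleFrom M₁)
    flow-routed i = subst (λ m → Linked (Before (λ m → s m (flowJob i)) (λ _ → p i)) (cycleFrom m))
      (first-flow i) (routed (flowJob i))

-- Makespans of the tight instance

2ℚ 3ℚ 4ℚ : ℚ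
2ℚ = + 2 / 1
3ℚ = + 3 / 1
4ℚ = + 4 / 1

-- A record and not a nested product: records at convertible instances are compared
-- without unfolding the makespans, which would be prohibitively expensive.
record Makespans (I : Instance) (3≤k : 3 ℕ.≤ Instance.k I) (a b : ℚ) : Set where
  constructor makespans-of
  field
    π-exists         : ∃[ π ] Is-π I 3≤k π
    makespan-π       : ∀ π → Is-π I 3≤k π → Schedule.makespan π ≡ + 4 / 1 + a
    optimum-exists   : ∃[ σ ] IsOptimal {I} σ
    makespan-optimum : ∀ σ → IsOptimal {I} σ → Schedule.makespan σ ≡ + 3 / 1 + a + b

-- The sizes are successors here, so that `drop 2 openJobs` and the patterns on open-shop indices
-- compute. The fractions stay abstract: beyond positivity and order of the times, they enter
-- through `a-sum` and `b-sum`.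
module Tight
  (m e : ℕ) (p : Fin (3 ℕ.+ m) → ℚ) (q : Fin (3 ℕ.+ e) → ℚ)
  (p-pos : ∀ i → 0ℚ < p i) (q-pos : ∀ i → 0ℚ < q i)
  (p-sorted : ∀ {i j} → i Fin.≤ j → p j ≤ p i) (q-sorted : ∀ {i j} → i Fin.≤ j → q j ≤ q i)
  (3≤k : 3 ℕ.≤ 3 ℕ.+ e) (a b : ℚ)
  (p≡a : ∀ i → p i ≡ a) (q₀≡1 : q zero ≡ 1ℚ) (q≡b : ∀ i → q (suc i) ≡ b)
  (a-sum : (2 ℕ.+ m) · a ≡ 1ℚ) (b-sum : (1 ℕ.+ e) · b ≡ 1ℚ)
  where

  I : Instance
  I = record { p = p ; q = q ; p-pos = p-pos ; q-pos = q-pos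
             ; p-sorted = p-sorted ; q-sorted = q-sorted }

  open Instance I using (ℓ; k; time; flowJobs; openJobs; allJobs)
  open Schedule using (start; finish; makespan; start≥0)

  0<a : 0ℚ < a
  0<a = subst (0ℚ <_) (p≡a zero) (p-pos zero)

  0≤a : 0ℚ ≤ a
  0≤a = <⇒≤ 0<a

  0≤b : 0ℚ ≤ b
  0≤b = subst (0ℚ ≤_) (q≡b zero) (<⇒≤ (q-pos (suc zero)))

  -- Since ℓ - 1 is at least 2, two copies of `a` already fit into `a-sum`. For `b` only one copy is
  -- sure to occur, hence the weak bound below.
  a<1 : a < 1ℚ
  a<1 = subst (a <_) a-sum (<-≤-trans
    (subst (_< a + a) (+-identityʳ a) (+-monoʳ-< a 0<a))
    (+-monoʳ-≤ a (x≤x+y (·-nonNeg m 0≤a))))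

  b≤1 : b ≤ 1ℚ
  b≤1 = subst (b ≤_) b-sum (x≤x+y (·-nonNeg e 0≤b))

  0≤1-a : 0ℚ ≤ 1ℚ - a
  0≤1-a = x≤y⇒0≤y-x (<⇒≤ a<1)

  0≤1-b : 0ℚ ≤ 1ℚ - b
  0≤1-b = x≤y⇒0≤y-x b≤1

  0≤1 : 0ℚ ≤ 1ℚ
  0≤1 = <⇒≤ (positive⁻¹ 1ℚ)

  0≤2 : 0ℚ ≤ 2ℚ
  0≤2 = <⇒≤ (positive⁻¹ 2ℚ)

  0≤3 : 0ℚ ≤ 3ℚ
  0≤3 = <⇒≤ (positive⁻¹ 3ℚ)

  at : ∀ {s : Job ℓ k → ℚ} {c j js u} t t′ → s j ≡ t → time j ≡ c → t + c ≡ t′ →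
       Run s time t′ js u → Run s time t (j ∷ js) u
  at _ _ eq refl refl r = eq ∷ r

  -- One flow-shop job takes `a` and the other ℓ - 1 together take 1.
  flow-run : ∀ {s : Job ℓ k → ℚ} t u → (∀ i → s (flowJob i) ≡ t + toℕ i · a) →
             t + (a + 1ℚ) ≡ u → Run s time t flowJobs u
  flow-run t _ starts end =
    run-tabulate flowJob id starts p≡a (trans (cong (λ x → t + (a + x)) a-sum) end)

  drop₁-run : ∀ {s : Job ℓ k → ℚ} t u → (∀ i → s (openJob (suc i)) ≡ t + toℕ i · b) →
              t + (b + 1ℚ) ≡ u → Run s time t (drop 1 openJobs) u
  drop₁-run t _ starts end =
    run-tabulate openJob suc starts q≡b (trans (cong (λ x → t + (b + x)) b-sum) end)

  drop₂-run : ∀ {s : Job ℓ k → ℚ} t u → (∀ i → s (openJob (suc (suc i))) ≡ t + toℕ i · b) →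
              t + 1ℚ ≡ u → Run s time t (drop 2 openJobs) u
  drop₂-run t _ starts end =
    run-tabulate openJob (λ i → suc (suc i)) starts (λ i → q≡b (suc i))
      (trans (cong (_+_ t) b-sum) end)

  -- Puts the value of the processing time in place of `time j`, which turns the routing
  -- inequalities into linear ones for the solver.
  timed : ∀ {f : Machine → ℚ} {t c ms} → t ≡ c →
          Linked (Before f (λ _ → c)) ms → Linked (Before f (λ _ → t)) ms
  timed refl l = l

  -- The schedule π and its makespan

  module π where

    -- The short jobs from J_{ℓ+3} on fill [0,1], [1,2] and [2,3] on the three machines, and the
    -- flow-shop block of length 1 + a follows at once. The summand `0ℚ` keeps the shape that
    -- `run-tabulate` expects.
    s : Machine → Job ℓ k → ℚ
    s M₁ (flowJob i)             = 1ℚ + toℕ i · a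
    s M₂ (flowJob i)             = 2ℚ + toℕ i · a
    s M₃ (flowJob i)             = 3ℚ + toℕ i · a
    s M₁ (openJob zero)          = 2ℚ + a
    s M₂ (openJob zero)          = 3ℚ + a
    s M₃ (openJob zero)          = 0ℚ
    s M₁ (openJob (suc zero))    = 3ℚ + a
    s M₂ (openJob (suc zero))    = 0ℚ
    s M₃ (openJob (suc zero))    = 1ℚ
    s M₁ (openJob (suc (suc i))) = 0ℚ + toℕ i · b
    s M₂ (openJob (suc (suc i))) = 1ℚ + toℕ i · b
    s M₃ (openJob (suc (suc i))) = 2ℚ + toℕ i · b

    s≥0 : ∀ m j → 0ℚ ≤ s m j
    s≥0 M₁ (flowJob i)             = +-nonNeg 0≤1 (·-nonNeg (toℕ i) 0≤a)
    s≥0 M₂ (flowJob i)             = +-nonNeg 0≤2 (·-nonNeg (toℕ i) 0≤a)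
    s≥0 M₃ (flowJob i)             = +-nonNeg 0≤3 (·-nonNeg (toℕ i) 0≤a)
    s≥0 M₁ (openJob zero)          = +-nonNeg 0≤2 0≤a
    s≥0 M₂ (openJob zero)          = +-nonNeg 0≤3 0≤a
    s≥0 M₃ (openJob zero)          = ≤-refl
    s≥0 M₁ (openJob (suc zero))    = +-nonNeg 0≤3 0≤a
    s≥0 M₂ (openJob (suc zero))    = ≤-refl
    s≥0 M₃ (openJob (suc zero))    = 0≤1
    s≥0 M₁ (openJob (suc (suc i))) = +-nonNeg ≤-refl (·-nonNeg (toℕ i) 0≤b)
    s≥0 M₂ (openJob (suc (suc i))) = +-nonNeg 0≤1 (·-nonNeg (toℕ i) 0≤b)
    s≥0 M₃ (openJob (suc (suc i))) = +-nonNeg 0≤2 (·-nonNeg (toℕ i) 0≤b)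

    run₁ : Run (s M₁) time 0ℚ (order I 3≤k M₁) (3ℚ + a + b)
    run₁ =
      drop₂-run 0ℚ 1ℚ (λ _ → refl) refl ++ʳ
      flow-run 1ℚ (2ℚ + a) (λ _ → refl)
        (solve 1 (λ a → con 1ℚ :+ (a :+ con 1ℚ) := con 2ℚ :+ a) refl a) ++ʳ
      at (2ℚ + a) (3ℚ + a) refl q₀≡1
        (solve 1 (λ a → con 2ℚ :+ a :+ con 1ℚ := con 3ℚ :+ a) refl a)
        (at (3ℚ + a) (3ℚ + a + b) refl (q≡b zero) refl (stop refl))

    -- J_{ℓ+2} is left out: it ends at `b`, possibly before the prescribed start 1 of J_{ℓ+3}.
    run₂ : Run (s M₂) time 1ℚ (drop 2 openJobs ++ flowJobs ++ take 1 openJobs) (4ℚ + a)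
    run₂ =
      drop₂-run 1ℚ 2ℚ (λ _ → refl) refl ++ʳ
      flow-run 2ℚ (3ℚ + a) (λ _ → refl)
        (solve 1 (λ a → con 2ℚ :+ (a :+ con 1ℚ) := con 3ℚ :+ a) refl a) ++ʳ
      at (3ℚ + a) (4ℚ + a) refl q₀≡1
        (solve 1 (λ a → con 3ℚ :+ a :+ con 1ℚ := con 4ℚ :+ a) refl a)
        (stop refl)

    -- J_{ℓ+1} and J_{ℓ+2} are left out: they end at 1 and 1 + b, and J_{ℓ+3} is prescribed to start
    -- at 2.
    run₃ : Run (s M₃) time 2ℚ (drop 2 openJobs ++ flowJobs) (4ℚ + a)
    run₃ =
      drop₂-run 2ℚ 3ℚ (λ _ → refl) refl ++ʳ
      flow-run 3ℚ (4ℚ + a) (λ _ → refl)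
        (solve 1 (λ a → con 3ℚ :+ (a :+ con 1ℚ) := con 4ℚ :+ a) refl a)

    J₁ J₂ : Job ℓ k
    J₁ = J[ℓ+1] I 3≤k
    J₂ = J[ℓ+2] I 3≤k

    finish₂-J₂ : 0ℚ + time J₂ ≤ 1ℚ
    finish₂-J₂ rewrite q≡b zero = ≤-trans (≤-reflexive (+-identityˡ b)) b≤1

    finish₃-J₁ : 0ℚ + time J₁ ≤ 1ℚ
    finish₃-J₁ rewrite q₀≡1 = ≤-refl

    finish₃-J₂ : 1ℚ + time J₂ ≤ 2ℚ
    finish₃-J₂ rewrite q≡b zero = +-monoʳ-≤ 1ℚ b≤1

    ordered : ∀ m → AllPairs (Before (s m) time) (order I 3≤k m)
    ordered M₁ = run-ordered (time≥0 {I}) run₁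
    ordered M₂ = All.map (≤-trans finish₂-J₂) (run-starts (time≥0 {I}) run₂) ∷
                 run-ordered (time≥0 {I}) run₂
    ordered M₃ = (finish₃-J₁ ∷ All.map (≤-trans (≤-trans finish₃-J₁ 1≤2)) (run-starts (time≥0 {I}) run₃)) ∷
                 All.map (≤-trans finish₃-J₂) (run-starts (time≥0 {I}) run₃) ∷
                 run-ordered (time≥0 {I}) run₃
      where
      1≤2 : 1ℚ ≤ 2ℚ
      1≤2 = x≤x+y 0≤1

    first : Job ℓ k → Machine
    first (flowJob _)             = M₁
    first (openJob zero)          = M₃
    first (openJob (suc zero))    = M₂
    first (openJob (suc (suc _))) = M₁

    routed : ∀ j → Linked (Before (λ m → s m j) (λ _ → time j)) (cycleFrom {I} (first j))
    -- Each start is 1 later than on the machine before, while the job takes `a`; the slack is 1 -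
    -- a.
    routed (flowJob i) = timed (p≡a i) (
      ≤-by _ 0≤1-a (solve 2 (λ a x → con 2ℚ :+ x := con 1ℚ :+ x :+ a :+ (con 1ℚ :- a)) refl a (toℕ i · a)) ∷
      ≤-by _ 0≤1-a (solve 2 (λ a x → con 3ℚ :+ x := con 2ℚ :+ x :+ a :+ (con 1ℚ :- a)) refl a (toℕ i · a)) ∷
      [-])
    routed (openJob zero) = timed q₀≡1 (
      ≤-by _ (+-nonNeg 0≤1 0≤a) (solve 1 (λ a → con 2ℚ :+ a := con 0ℚ :+ con 1ℚ :+ (con 1ℚ :+ a)) refl a) ∷
      ≤-reflexive (solve 1 (λ a → con 2ℚ :+ a :+ con 1ℚ := con 3ℚ :+ a) refl a) ∷
      [-])
    routed (openJob (suc zero)) =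
      finish₂-J₂ ∷
      ≤-trans finish₃-J₂ (≤-by _ (+-nonNeg 0≤1 0≤a)
        (solve 1 (λ a → con 3ℚ :+ a := con 2ℚ :+ (con 1ℚ :+ a)) refl a)) ∷
      [-]
    routed (openJob (suc (suc i))) = timed (q≡b (suc i)) (
      ≤-by _ 0≤1-b (solve 2 (λ b y → con 1ℚ :+ y := con 0ℚ :+ y :+ b :+ (con 1ℚ :- b)) refl b (toℕ i · b)) ∷
      ≤-by _ 0≤1-b (solve 2 (λ b y → con 2ℚ :+ y := con 1ℚ :+ y :+ b :+ (con 1ℚ :- b)) refl b (toℕ i · b)) ∷
      [-])

    σ : Schedule I
    σ = schedule s s≥0 (order I 3≤k) (∈-order 3≤k) ordered first (λ _ → refl) routed

    σ-respects : Respects-π I 3≤k σ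
    σ-respects = record
      { ordered   = ordered
      ; ℓ+3-on-M₁ = refl
      ; ℓ+3-on-M₂ = sym q₀≡1
      ; ℓ+3-on-M₃ = sym (cong₂ _+_ q₀≡1 q₀≡1)
      ; ℓ+2-on-M₂ = refl
      ; ℓ+2-on-M₃ = sym q₀≡1
      ; ℓ+1-on-M₃ = refl
      }

    -- On `M₂` and `M₃` the jobs ahead of the run are compared one by one; the prescribed start of
    -- J_{ℓ+3} then bounds the rest of the order from below by the start of the run.
    σ-earliest : ∀ τ → Respects-π I 3≤k τ → ∀ m j → s m j ≤ start τ m j
    σ-earliest τ respects m j = All.lookup (earliest m) (∈-order {I} 3≤k m j)
      where
      module R = Respects-π respects

      earliest : ∀ m → All (λ j → s m j ≤ start τ m j) (order I 3≤k m)
      earliest M₁ = run-earliest run₁ (R.ordered M₁) (All.tabulate (λ {j} _ → start≥0 τ M₁ j))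
      earliest M₂ with R.ordered M₂
      ... | _ ∷ bs = start≥0 τ M₂ J₂ ∷ run-earliest run₂ bs
        (starts-after (time≥0 {I}) (≤-reflexive (sym (trans R.ℓ+3-on-M₂ q₀≡1))) bs)
      earliest M₃ with R.ordered M₃
      ... | _ ∷ _ ∷ bs = start≥0 τ M₃ J₁ ∷ ≤-reflexive (sym (trans R.ℓ+2-on-M₃ q₀≡1)) ∷
        run-earliest run₃ bs (starts-after (time≥0 {I})
          (≤-reflexive (sym (trans R.ℓ+3-on-M₃ (cong₂ _+_ q₀≡1 q₀≡1)))) bs)

    σ-isπ : Is-π I 3≤k σ
    σ-isπ = record
      { p₁<q[ℓ+1] = λ i _ → subst (p i <_) (sym q₀≡1) (subst (_< 1ℚ) (sym (p≡a i)) a<1)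
      ; respects  = σ-respects
      ; earliest  = σ-earliest
      }

    finish≤ : ∀ m → All (λ j → s m j + time j ≤ 4ℚ + a) (order I 3≤k m)
    finish≤ M₁ = All.map
      (λ f≤ → ≤-trans f≤ (≤-by _ 0≤1-b
        (solve 2 (λ a b → con 4ℚ :+ a := con 3ℚ :+ a :+ b :+ (con 1ℚ :- b)) refl a b)))
      (run-finishes (time≥0 {I}) run₁)
    finish≤ M₂ = ≤-trans finish₂-J₂ (run-length (time≥0 {I}) run₂) ∷ run-finishes (time≥0 {I}) run₂
    -- Here `run₂` only supplies 1 ≤ 4 + a.
    finish≤ M₃ = ≤-trans finish₃-J₁ (run-length (time≥0 {I}) run₂) ∷
                 ≤-trans finish₃-J₂ (run-length (time≥0 {I}) run₃) ∷ run-finishes (time≥0 {I}) run₃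

    makespan-σ : makespan σ ≡ 4ℚ + a
    makespan-σ = ≤-antisym
      (makespan≤ σ (≤-trans 0≤1 (run-length (time≥0 {I}) run₂))
        (λ m j → All.lookup (finish≤ m) (∈-order {I} 3≤k m j)))
      (≤-trans
        (≤-reflexive (trans (solve 1 (λ a → con 4ℚ :+ a := con 3ℚ :+ a :+ con 1ℚ) refl a)
          (cong (λ x → 3ℚ + a + x) (sym q₀≡1))))
        (finish≤makespan σ M₂ J₁))

    -- Both `τ` and `σ` are earliest among the schedules that respect π, so each makespan bounds the
    -- other.
    makespan-π : ∀ τ → Is-π I 3≤k τ → makespan τ ≡ 4ℚ + a
    makespan-π τ isπ = trans
      (≤-antisym (makespan-mono τ σ (Is-π.earliest isπ σ σ-respects))
                 (makespan-mono σ τ (σ-earliest τ (Is-π.respects isπ))))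
      makespan-σ

  -- An optimal schedule without idle time

  module Optimal where

    T : ℚ
    T = 3ℚ + a + b

    s : Machine → Job ℓ k → ℚ
    s M₁ (flowJob i)       = 0ℚ + toℕ i · a
    s M₂ (flowJob i)       = 1ℚ + b + toℕ i · a
    s M₃ (flowJob i)       = 2ℚ + b + toℕ i · a
    s M₁ (openJob zero)    = 1ℚ + a
    s M₂ (openJob zero)    = 2ℚ + a + b
    s M₃ (openJob zero)    = 0ℚ
    s M₁ (openJob (suc i)) = 2ℚ + a + toℕ i · b
    s M₂ (openJob (suc i)) = 0ℚ + toℕ i · b
    s M₃ (openJob (suc i)) = 1ℚ + toℕ i · b

    s≥0 : ∀ m j → 0ℚ ≤ s m j
    s≥0 M₁ (flowJob i)       = +-nonNeg ≤-refl (·-nonNeg (toℕ i) 0≤a)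
    s≥0 M₂ (flowJob i)       = +-nonNeg (+-nonNeg 0≤1 0≤b) (·-nonNeg (toℕ i) 0≤a)
    s≥0 M₃ (flowJob i)       = +-nonNeg (+-nonNeg 0≤2 0≤b) (·-nonNeg (toℕ i) 0≤a)
    s≥0 M₁ (openJob zero)    = +-nonNeg 0≤1 0≤a
    s≥0 M₂ (openJob zero)    = +-nonNeg (+-nonNeg 0≤2 0≤a) 0≤b
    s≥0 M₃ (openJob zero)    = ≤-refl
    s≥0 M₁ (openJob (suc i)) = +-nonNeg (+-nonNeg 0≤2 0≤a) (·-nonNeg (toℕ i) 0≤b)
    s≥0 M₂ (openJob (suc i)) = +-nonNeg ≤-refl (·-nonNeg (toℕ i) 0≤b)
    s≥0 M₃ (openJob (suc i)) = +-nonNeg 0≤1 (·-nonNeg (toℕ i) 0≤b)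

    -- Only `M₁` departs from the orders of π: the flow-shop jobs come first there, and all short
    -- jobs go last.
    sequence : Machine → List (Job ℓ k)
    sequence M₁ = allJobs
    sequence M₂ = order I 3≤k M₂
    sequence M₃ = order I 3≤k M₃

    ∈-sequence : ∀ m j → j ∈ sequence m
    ∈-sequence M₁ = ∈-allJobs {I}
    ∈-sequence M₂ = ∈-order {I} 3≤k M₂
    ∈-sequence M₃ = ∈-order {I} 3≤k M₃

    run : ∀ m → Run (s m) time 0ℚ (sequence m) T
    run M₁ =
      flow-run 0ℚ (1ℚ + a) (λ _ → refl)
        (solve 1 (λ a → con 0ℚ :+ (a :+ con 1ℚ) := con 1ℚ :+ a) refl a) ++ʳ
      at (1ℚ + a) (2ℚ + a) refl q₀≡1
        (solve 1 (λ a → con 1ℚ :+ a :+ con 1ℚ := con 2ℚ :+ a) refl a)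
        (drop₁-run (2ℚ + a) T (λ _ → refl)
          (solve 2 (λ a b → con 2ℚ :+ a :+ (b :+ con 1ℚ) := con 3ℚ :+ a :+ b) refl a b))
    run M₂ =
      drop₁-run 0ℚ (1ℚ + b) (λ _ → refl)
        (solve 1 (λ b → con 0ℚ :+ (b :+ con 1ℚ) := con 1ℚ :+ b) refl b) ++ʳ
      flow-run (1ℚ + b) (2ℚ + a + b) (λ _ → refl)
        (solve 2 (λ a b → con 1ℚ :+ b :+ (a :+ con 1ℚ) := con 2ℚ :+ a :+ b) refl a b) ++ʳ
      at (2ℚ + a + b) T refl q₀≡1
        (solve 2 (λ a b → con 2ℚ :+ a :+ b :+ con 1ℚ := con 3ℚ :+ a :+ b) refl a b)
        (stop refl)
    run M₃ =
      at 0ℚ 1ℚ refl q₀≡1 refl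
        (drop₁-run 1ℚ (2ℚ + b) (λ _ → refl)
          (solve 1 (λ b → con 1ℚ :+ (b :+ con 1ℚ) := con 2ℚ :+ b) refl b) ++ʳ
        flow-run (2ℚ + b) T (λ _ → refl)
          (solve 2 (λ a b → con 2ℚ :+ b :+ (a :+ con 1ℚ) := con 3ℚ :+ a :+ b) refl a b))

    first : Job ℓ k → Machine
    first (flowJob _)       = M₁
    first (openJob zero)    = M₃
    first (openJob (suc _)) = M₂

    routed : ∀ j → Linked (Before (λ m → s m j) (λ _ → time j)) (cycleFrom {I} (first j))
    routed (flowJob i) = timed (p≡a i) (
      ≤-by _ (+-nonNeg 0≤b 0≤1-a) (solve 3 (λ a b x →
        con 1ℚ :+ b :+ x := con 0ℚ :+ x :+ a :+ (b :+ (con 1ℚ :- a))) refl a b (toℕ i · a)) ∷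
      ≤-by _ 0≤1-a (solve 3 (λ a b x →
        con 2ℚ :+ b :+ x := con 1ℚ :+ b :+ x :+ a :+ (con 1ℚ :- a)) refl a b (toℕ i · a)) ∷
      [-])
    routed (openJob zero) = timed q₀≡1 (
      ≤-by _ 0≤a (solve 1 (λ a → con 1ℚ :+ a := con 0ℚ :+ con 1ℚ :+ a) refl a) ∷
      ≤-by _ 0≤b (solve 2 (λ a b → con 2ℚ :+ a :+ b := con 1ℚ :+ a :+ con 1ℚ :+ b) refl a b) ∷
      [-])
    routed (openJob (suc i)) = timed (q≡b i) (
      ≤-by _ 0≤1-b (solve 2 (λ b y → con 1ℚ :+ y := con 0ℚ :+ y :+ b :+ (con 1ℚ :- b)) refl b (toℕ i · b)) ∷
      ≤-by _ (+-nonNeg 0≤a 0≤1-b) (solve 3 (λ a b y →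
        con 2ℚ :+ a :+ y := con 1ℚ :+ y :+ b :+ (a :+ (con 1ℚ :- b))) refl a b (toℕ i · b)) ∷
      [-])

    σ : Schedule I
    σ = schedule s s≥0 sequence ∈-sequence (λ m → run-ordered (time≥0 {I}) (run m))
      first (λ _ → refl) routed

    T≤makespan : ∀ τ → T ≤ makespan {I} τ
    T≤makespan τ = ≤-trans
      -- As `sequence M₁` is `allJobs`, the run on `M₁` also evaluates the load.
      (≤-reflexive (trans (sym (run-total (run M₁))) (+-identityˡ _)))
      (load≤makespan τ)

    makespan-σ≤T : makespan σ ≤ T
    makespan-σ≤T = makespan≤ σ (run-length (time≥0 {I}) (run M₁))
      (λ m j → All.lookup (run-finishes (time≥0 {I}) (run m)) (∈-sequence m j))

    σ-optimal : IsOptimal σ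
    σ-optimal τ = ≤-trans makespan-σ≤T (T≤makespan τ)

    makespan-optimal : ∀ τ → IsOptimal {I} τ → makespan τ ≡ T
    makespan-optimal τ optimal = ≤-antisym (≤-trans (optimal σ) makespan-σ≤T) (T≤makespan τ)

  makespans : Makespans I 3≤k a b
  makespans = makespans-of (π.σ , π.σ-isπ) π.makespan-π
    (Optimal.σ , Optimal.σ-optimal) Optimal.makespan-optimal

-- Passes from an instance with bounds on its sizes to the successor form of `Tight`. The times of
-- the open-shop jobs are specified through `toℕ` because `k` is still a variable.
makespans : (I : Instance) (let open Instance I) (3≤k : 3 ℕ.≤ k) (a b : ℚ) → 3 ℕ.≤ ℓ →
            (∀ i → p i ≡ a) → (∀ i → toℕ i ≡ 0 → q i ≡ 1ℚ) → (∀ i → 0 ℕ.< toℕ i → q i ≡ b) →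
            (ℓ ℕ.∸ 1) · a ≡ 1ℚ → (k ℕ.∸ 2) · b ≡ 1ℚ →
            Makespans I 3≤k a b
makespans record { ℓ = ℕ.suc (ℕ.suc (ℕ.suc m)) ; k = ℕ.suc (ℕ.suc (ℕ.suc e)) ; p = p ; q = q
                 ; p-pos = p-pos ; q-pos = q-pos ; p-sorted = p-sorted ; q-sorted = q-sorted }
          3≤k a b _ p≡a q₀≡1 q≡b a-sum b-sum =
  Tight.makespans m e p q p-pos q-pos p-sorted q-sorted 3≤k a b
    p≡a (q₀≡1 zero refl) (λ i → q≡b (suc i) (ℕ.s≤s ℕ.z≤n)) a-sum b-sum
makespans record { k = 1 } (ℕ.s≤s ())
makespans record { k = 2 } (ℕ.s≤s (ℕ.s≤s ()))
makespans record { ℓ = 1 } _ _ _ (ℕ.s≤s ())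
makespans record { ℓ = 2 } _ _ _ (ℕ.s≤s (ℕ.s≤s ()))

-- Unit fractions and the limit of the ratio

1/d+k/d : ∀ d k .{{_ : ℕ.NonZero d}} → + 1 / d + + k / d ≡ + (ℕ.suc k) / d
1/d+k/d (ℕ.suc d) k = toℚᵘ-injective (begin
  -- The operation `_/_` reduces to lowest terms; among unnormalised fractions the claim is a
  -- polynomial identity.
  toℚᵘ (fromℚᵘ (mkℚᵘ (+ 1) d) + fromℚᵘ (mkℚᵘ (+ k) d))
    ≈⟨ toℚᵘ-homo-+ (fromℚᵘ (mkℚᵘ (+ 1) d)) (fromℚᵘ (mkℚᵘ (+ k) d)) ⟩
  toℚᵘ (fromℚᵘ (mkℚᵘ (+ 1) d)) ℚᵘ.+ toℚᵘ (fromℚᵘ (mkℚᵘ (+ k) d))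
    ≈⟨ ℚᵘ.+-cong (toℚᵘ-fromℚᵘ (mkℚᵘ (+ 1) d)) (toℚᵘ-fromℚᵘ (mkℚᵘ (+ k) d)) ⟩
  mkℚᵘ (+ 1) d ℚᵘ.+ mkℚᵘ (+ k) d
    ≈⟨ *≡* (numerators (+ k) (+ (ℕ.suc d))) ⟩
  mkℚᵘ (+ (ℕ.suc k)) d
    ≈⟨ toℚᵘ-fromℚᵘ (mkℚᵘ (+ (ℕ.suc k)) d) ⟨
  toℚᵘ (fromℚᵘ (mkℚᵘ (+ (ℕ.suc k)) d)) ∎)
  where
  open import Relation.Binary.Reasoning.Setoid ℚᵘ.≃-setoid

  numerators : ∀ k d → (+ 1 ℤ.* d ℤ.+ k ℤ.* d) ℤ.* d ≡ (+ 1 ℤ.+ k) ℤ.* (d ℤ.* d)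
  numerators = solve-∀

k·1/d : ∀ d k .{{_ : ℕ.NonZero d}} → k · (+ 1 / d) ≡ + k / d
k·1/d d ℕ.zero    = sym (0/n≡0 d)
k·1/d d (ℕ.suc k) = trans (cong (_+_ (+ 1 / d)) (k·1/d d k)) (1/d+k/d d k)

d·1/d : ∀ d .{{_ : ℕ.NonZero d}} → d · (+ 1 / d) ≡ 1ℚ
d·1/d d@(ℕ.suc _) = trans (k·1/d d d) (fromℚᵘ-cong {mkℚᵘ (+ d) _} {mkℚᵘ (+ 1) 0} (*≡* (ℤ.*-comm (+ d) (+ 1))))

-- A positive rational has numerator at least 1, so it is at least the reciprocal of its
-- denominator.
1/d≤ : ∀ {ε} d .{{_ : ℕ.NonZero d}} → 0ℚ < ε → ↧ₙ ε ℕ.≤ d → + 1 / d ≤ ε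
1/d≤ {mkℚ (+ ℕ.suc n) _ _} (ℕ.suc d) _ ↧ε≤d = toℚᵘ-cancel-≤
  (ℚᵘ.≤-respˡ-≃ (ℚᵘ.≃-sym (toℚᵘ-fromℚᵘ (mkℚᵘ (+ 1) d)))
    (ℚᵘ.*≤* (ℤ.+≤+ (ℕ.≤-trans (ℕ.≤-reflexive (ℕ.*-identityˡ _))
      (ℕ.≤-trans ↧ε≤d (ℕ.m≤n*m (ℕ.suc d) (ℕ.suc n)))))))
1/d≤ {mkℚ (+ ℕ.zero) _ _} _ (*<* (ℤ.+<+ ()))
1/d≤ {mkℚ ℤ.-[1+ _ ] _ _} _ (*<* ())

÷-*-cancel : ∀ x y .{{_ : NonZero y}} → (x ÷ y) * y ≡ x
÷-*-cancel x y = trans (*-assoc x (1/ y) y) (trans (cong (x *_) (*-inverseˡ y)) (*-identityʳ x))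

-- Multiplication by the positive `s` replaces the quotient by polynomial inequalities. As `r` never
-- exceeds 4/3, the smallness of `a` and `b` matters only for the lower estimate.
ratio-bound : ∀ {r a b ε} → 0ℚ ≤ a → 0ℚ ≤ b → a ≤ ε → b ≤ ε → 0ℚ < ε →
              r * (3ℚ + a + b) ≡ 4ℚ + a → ∣ r - + 4 / 3 ∣ < ε
ratio-bound {r} {a} {b} {ε} 0≤a 0≤b a≤ε b≤ε 0<ε rs≡ =
  [ (λ ∣x∣≡x → subst (_< ε) (sym ∣x∣≡x) (≤-<-trans r-4/3≤0 0<ε))
  , (λ ∣x∣≡-x → subst (_< ε) (sym ∣x∣≡-x) 4/3-r<ε) ]′
  (∣p∣≡p∨∣p∣≡-p (r - 4/3))
  where
  1/3 4/3 s : ℚ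
  1/3 = + 1 / 3
  4/3 = + 4 / 3
  s = 3ℚ + a + b

  instance
    s-pos : Positive s
    s-pos = positive (<-≤-trans (positive⁻¹ 3ℚ) (≤-trans (x≤x+y 0≤a) (x≤x+y 0≤b)))

    s-nonNeg : NonNegative s
    s-nonNeg = pos⇒nonNeg s

  scale-≥0 : ∀ c {x} .{{_ : NonNegative c}} → 0ℚ ≤ x → 0ℚ ≤ c * x
  scale-≥0 c {x} 0≤x = subst (_≤ c * x) (*-zeroʳ c) (*-monoˡ-≤-nonNeg c 0≤x)

  r≤4/3 : r ≤ 4/3
  r≤4/3 = *-cancelʳ-≤-pos s (≤-trans (≤-reflexive rs≡)
    (≤-by (1/3 * a + 4/3 * b) (+-nonNeg (scale-≥0 1/3 0≤a) (scale-≥0 4/3 0≤b))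
      (solve 2 (λ a b → con 4/3 :* (con 3ℚ :+ a :+ b) :=
        con 4ℚ :+ a :+ (con 1/3 :* a :+ con 4/3 :* b)) refl a b)))

  r-4/3≤0 : r - 4/3 ≤ 0ℚ
  r-4/3≤0 = subst (r - 4/3 ≤_) (+-inverseʳ 4/3) (+-monoˡ-≤ (- 4/3) r≤4/3)

  -- The difference (r + ε) s - 4/3 s, arranged as a sum of nonnegative terms.
  slack : ℚ
  slack = 1/3 * (ε - a) + 4/3 * (ε - b) + ε * (a + b) + 4/3 * ε

  0<slack : 0ℚ < slack
  -- Strictness comes from the last summand `4/3 * ε`.
  0<slack = +-mono-≤-<
    (+-nonNeg (+-nonNeg (scale-≥0 1/3 (x≤y⇒0≤y-x a≤ε)) (scale-≥0 4/3 (x≤y⇒0≤y-x b≤ε)))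
      (scale-≥0 ε {{nonNegative (<⇒≤ 0<ε)}} (+-nonNeg 0≤a 0≤b)))
    (subst (_< 4/3 * ε) (*-zeroʳ 4/3) (*-monoʳ-<-pos 4/3 0<ε))

  4/3<r+ε : 4/3 < r + ε
  4/3<r+ε = *-cancelʳ-<-nonNeg s (begin-strict
    4/3 * s               <⟨ subst (_< 4/3 * s + slack) (+-identityʳ _) (+-monoʳ-< (4/3 * s) 0<slack) ⟩
    4/3 * s + slack       ≡⟨ solve 3 (λ a b ε →
      con 4/3 :* (con 3ℚ :+ a :+ b) :+
        (con 1/3 :* (ε :- a) :+ con 4/3 :* (ε :- b) :+ ε :* (a :+ b) :+ con 4/3 :* ε) :=
      con 4ℚ :+ a :+ ε :* (con 3ℚ :+ a :+ b)) refl a b ε ⟩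
    4ℚ + a + ε * s        ≡⟨ cong (_+ε*s) rs≡ ⟨
    r * s + ε * s         ≡⟨ *-distribʳ-+ s r ε ⟨
    (r + ε) * s           ∎)
    where
    open ≤-Reasoning
    _+ε*s : ℚ → ℚ
    x +ε*s = x + ε * s

  4/3-r<ε : - (r - 4/3) < ε
  4/3-r<ε = begin-strict
    - (r - 4/3)   ≡⟨ solve 1 (λ r → :- (r :- con 4/3) := con 4/3 :- r) refl r ⟩
    4/3 - r       <⟨ +-monoˡ-< (- r) 4/3<r+ε ⟩
    r + ε - r     ≡⟨ solve 2 (λ r ε → r :+ ε :- r := ε) refl r ε ⟩
    ε             ∎
    where open ≤-Reasoning

-- Application to the given instance

module _ (ℓ n : ℕ) (3≤ℓ : 3 ℕ.≤ ℓ) (ℓ+3≤n : ℓ ℕ.+ 3 ℕ.≤ n) where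
  open TightInstance ℓ n 3≤ℓ ℓ+3≤n

  tight-makespans : Makespans tight 3≤n∸ℓ 1/[ℓ-1] 1/[n-ℓ-2]
  tight-makespans = makespans tight 3≤n∸ℓ 1/[ℓ-1] 1/[n-ℓ-2] 3≤ℓ (λ _ → refl)
    openTime-first openTime-rest (d·1/d (ℓ ℕ.∸ 1)) (d·1/d (n ℕ.∸ ℓ ℕ.∸ 2))
    where
    openTime-first : ∀ {k} (i : Fin k) → toℕ i ≡ 0 → openTime i ≡ 1ℚ
    openTime-first zero _ = refl

    openTime-rest : ∀ {k} (i : Fin k) → 0 ℕ.< toℕ i → openTime i ≡ 1/[n-ℓ-2]
    openTime-rest (suc _) _ = refl

mainTheorem3 : (∀ ℓ n (3≤ℓ : 3 ℕ.≤ ℓ) (ℓ+3≤n : ℓ ℕ.+ 3 ℕ.≤ n) →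
    let open TightInstance ℓ n 3≤ℓ ℓ+3≤n in
    (∃[ π ] IsPi π) ×
    (∀ π → IsPi π → Schedule.makespan π ≡ + 4 / 1 + 1/[ℓ-1]) ×
    (∃[ σ ] IsOptimal {tight} σ) ×
    (∀ σ → IsOptimal {tight} σ →
    Schedule.makespan σ ≡ + 3 / 1 + 1/[ℓ-1] + 1/[n-ℓ-2]))
    ×
    (∀ (ε : ℚ) → 0ℚ < ε →
    ∃[ N ] (∀ ℓ n (3≤ℓ : 3 ℕ.≤ ℓ) (ℓ+3≤n : ℓ ℕ.+ 3 ℕ.≤ n) →
    N ℕ.≤ ℓ → N ℕ.≤ n ℕ.∸ ℓ →
    let open TightInstance ℓ n 3≤ℓ ℓ+3≤n in
    ∀ π σ → IsPi π → IsOptimal σ →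
    ∣ ratio π σ - + 4 / 3 ∣ < ε))
mainTheorem3 =
  (λ ℓ n 3≤ℓ ℓ+3≤n →
    let open Makespans (tight-makespans ℓ n 3≤ℓ ℓ+3≤n) in
    π-exists , makespan-π , optimum-exists , makespan-optimum) ,
  -- The 2 in the threshold makes n - ℓ - 2, and all the more ℓ - 1, at least the denominator of
  -- `ε`.
  (λ ε 0<ε → 2 ℕ.+ ↧ₙ ε , λ ℓ n 3≤ℓ ℓ+3≤n N≤ℓ N≤n∸ℓ π σ isπ optimal →
    let open TightInstance ℓ n 3≤ℓ ℓ+3≤n
        open Makespans (tight-makespans ℓ n 3≤ℓ ℓ+3≤n)
    in ratio-bound {ratio π σ} (<⇒≤ (0<1/d (ℓ ℕ.∸ 1))) (<⇒≤ (0<1/d (n ℕ.∸ ℓ ℕ.∸ 2)))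
         (1/d≤ (ℓ ℕ.∸ 1) 0<ε (ℕ.≤-trans (ℕ.n≤1+n _) (ℕ.∸-monoˡ-≤ 1 N≤ℓ)))
         (1/d≤ (n ℕ.∸ ℓ ℕ.∸ 2) 0<ε (ℕ.∸-monoˡ-≤ 2 N≤n∸ℓ))
         0<ε
         (trans (cong (ratio π σ *_) (sym (makespan-optimum σ optimal)))
           (trans (÷-*-cancel (Schedule.makespan π) (Schedule.makespan σ)
                    {{>-nonZero (makespan-pos σ)}})
             (makespan-π π isπ))))
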